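{- Let $\mathbb{F}_q$ be a finite field with $q$ elements. Let $\lambda/\mu$ be a ribbon, and let $s_{\lambda/\mu}$ be the corresponding skew Schur function. Let $a \in \mathbb{F}_q$. Then $$P(s_{\lambda/\mu} \mapsto a) = \frac{1}{q}.$$
   Context: A partition is a weakly decreasing finite sequence of positive integers $\lambda = (\lambda_1, \ldots, \lambda_k)$; its length is $\ell(\lambda) = k$, and one sets $\lambda_i := 0$ for $i > k$. Its Young diagram is $Y(\lambda) = \{(i,j) : 1 \leq i \leq k,\ 1 \leq j \leq \lambda_i\}$, whose elements are pictured as unit square boxes, $(i,j)$ being the $j$-th box from the left in the $i$-th row from the top. A skew partition $\lambda/\mu$ is a pair of partitions $(\lambda,\mu)$ with $\mu_i \leq \lambda_i$ for all $i \geq 1$; its (skew Young) diagram is $Y(\lambda/\mu) = Y(\lambda) \setminus Y(\mu)$. A skew partition $\lambda/\mu$ is connected if the interior of its diagram (regarded as the union of its boxes) is connected. A ribbon is a connected skew partition whose diagram does not contain any $2 \times 2$ block of boxes. Let $\mathcal{P} = \mathbb{Z}[h_1, h_2, h_3, \ldots]$ be the polynomial ring in countably many indeterminates, with $h_0 := 1$ and $h_m := 0$ for $m < 0$. For a skew partition $\lambda/\mu$ with $k = \ell(\lambda)$, the skew Schur function is $s_{\lambda/\mu} := \det\left( h_{\lambda_i - \mu_j - i + j} \right)_{1 \leq i,j \leq k} \in \mathcal{P}$. For $f \in \mathcal{P}$ and $a \in \mathbb{F}_q$, choose $N$ such that $f$ involves only $h_1, \ldots, h_N$; then the probability of $f$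 evaluating to $a$ is $$P(f \mapsto a) := \frac{\#\{(z_1, \ldots, z_N) \in \mathbb{F}_q^N \mid f(z_1, \ldots, z_N) = a\}}{q^N},$$ where the integer coefficients of $f$ are mapped to $\mathbb{F}_q$. This does not depend on the choice of $N$. -}

module Defs where

open import Level using (Level; 0ℓ; _⊔_) renaming (suc to lsuc)
open import Algebra.Apartness.Bundles using (HeytingField; HeytingCommutativeRing)
open import Algebra.Bundles using (CommutativeRing)
open import Algebra.Bundles.Raw using (RawRing)
import Algebra.Definitions.RawSemiring as RawSemiringDefinitions
open import Data.Fin.Base as Fin using (Fin; toℕ)
open import Data.Fin.Properties as Fin using (nonZeroIndex)
open import Data.Integer.Base as ℤ using (ℤ; +_; -[1+_]; 0ℤ; 1ℤ)
open import Data.List.Base as List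
  using (List; []; _∷_; _++_; concat; length; map; foldr; filter; allFin; cartesianProductWith)
open import Data.List.Extrema.Nat using (max; xs≤max)
open import Data.List.Properties using (≡-dec)
open import Data.List.Relation.Binary.Permutation.Propositional using (↭-sym)
open import Data.List.Relation.Binary.Permutation.Propositional.Properties using (All-resp-↭)
open import Data.List.Relation.Unary.All as All using (All; []; _∷_)
open import Data.List.Relation.Unary.All.Properties as All using (concat⁻; map⁻)
open import Data.List.Relation.Unary.Linked using (Linked)
open import Data.Nat.Base as ℕ using (ℕ; zero; suc; _≤_; _<_; _≥_; NonZero; s≤s; ∣_-_∣)
open import Data.Nat.Properties as ℕ using (≤-decTotalOrder; m^n≢0)
open import Data.List.Sort ≤-decTotalOrder using (sort; sort-↭)
open import Data.Product.Base using (_×_; _,_; ∃; proj₁; proj₂)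
open import Data.Rational.Base as ℚ using (ℚ)
open import Data.Vec.Base as Vec using (Vec)
open import Data.Vec.Functional using (removeAt)
open import Function.Base using (_on_)
open import Function.Bundles using (Inverse)
open import Function.Properties.Inverse using (Inverse⇒Injection)
open import Relation.Binary.Construct.Closure.ReflexiveTransitive using (Star)
open import Relation.Binary.Core using (Rel)
open import Relation.Binary.Definitions using (Decidable)
open import Relation.Binary.PropositionalEquality as ≡ using (_≡_; _≢_)
open import Relation.Nullary.Decidable using (via-injection)
open import Relation.Nullary.Decidable.Core using (yes; no)
open import Relation.Nullary.Negation using (¬_; contradiction)
open import Relation.Unary using (Pred; _∈_; _∖_; Satisfiable)

private
  variable
    c ℓ ℓ₁ ℓ₂ : Level

------------------------------------------------------------------------
-- Partitions and ribbons
--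
-- Rows and columns are numbered from 0.

record Partition : Set where
  field
    parts      : List ℕ
    positive   : All NonZero parts
    decreasing : Linked _≥_ parts

open Partition public using (parts)

ℓ[_] : Partition → ℕ
ℓ[ p ] = length (parts p)

nth : List ℕ → ℕ → ℕ
nth []       _       = 0
nth (x ∷ xs) zero    = x
nth (x ∷ xs) (suc i) = nth xs i

part : Partition → ℕ → ℕ
part p = nth (parts p)

Box : Set
Box = ℕ × ℕ

Diagram : Partition → Pred Box 0ℓ
Diagram p (i , j) = i < ℓ[ p ] × j < part p i

record SkewPartition : Set where
  field
    outer inner : Partition
    inner≤outer : ∀ i → part inner i ≤ part outer i

open SkewPartition public using (outer; inner)

SkewDiagram : SkewPartition → Pred Box 0ℓ
SkewDiagram s = Diagram (outer s) ∖ Diagram (inner s)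

-- The two unit squares share an edge.
Adjacent : Rel Box 0ℓ
Adjacent (i , j) (i′ , j′) = ∣ i - i′ ∣ ℕ.+ ∣ j - j′ ∣ ≡ 1

Step : Pred Box 0ℓ → Rel Box 0ℓ
Step D b b′ = b ∈ D × b′ ∈ D × Adjacent b b′

-- The interior of a union of unit boxes is connected exactly when the boxes
-- are connected through shared edges (a shared corner is not enough). As
-- usual for connectedness, the empty diagram is excluded.
Connected : Pred Box 0ℓ → Set
Connected D =
  Satisfiable D × (∀ {b b′} → b ∈ D → b′ ∈ D → Star (Step D) b b′)

Contains2×2 : Pred Box 0ℓ → Set
Contains2×2 D = ∃ λ i → ∃ λ j →
  (i , j) ∈ D × (i , suc j) ∈ D × (suc i , j) ∈ D × (suc i , suc j) ∈ D

Ribbon : Pred SkewPartition 0ℓ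
Ribbon s = Connected (SkewDiagram s) × ¬ Contains2×2 (SkewDiagram s)

------------------------------------------------------------------------
-- The polynomial ring ℤ[h₁, h₂, …]

-- A word in variable indices, read as a product; the index i stands for
-- hᵢ₊₁. Words that differ only by reordering are the same monomial.
Monomial : Set
Monomial = List ℕ

_≈ₘ_ : Rel Monomial 0ℓ
_≈ₘ_ = _≡_ on sort

_≈ₘ?_ : Decidable _≈ₘ_
m ≈ₘ? n = ≡-dec ℕ._≟_ (sort m) (sort n)

-- A formal sum of terms, in which a monomial may occur repeatedly and
-- coefficients may vanish; the equality of 𝓟 compares total coefficients.
Term : Set
Term = ℤ × Monomial

Polynomial : Set
Polynomial = List Term

mulTerm : Term → Term → Term
mulTerm (a , m) (b , n) = a ℤ.* b , m ++ n

negTerm : Term → Term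
negTerm (a , m) = ℤ.- a , m

coeff : Polynomial → Monomial → ℤ
coeff f m = foldr ℤ._+_ 0ℤ (map proj₁ (filter (λ t → proj₂ t ≈ₘ? m) f))

𝓟 : RawRing 0ℓ 0ℓ
𝓟 = record
  { Carrier = Polynomial
  ; _≈_     = λ f g → ∀ m → coeff f m ≡ coeff g m
  ; _+_     = _++_
  ; _*_     = cartesianProductWith mulTerm
  ; -_      = map negTerm
  ; 0#      = []
  ; 1#      = (1ℤ , []) ∷ []
  }

h : ℤ → Polynomial
h (+ 0)       = RawRing.1# 𝓟
h (+ (suc i)) = (1ℤ , i ∷ []) ∷ []
h -[1+ _ ]    = RawRing.0# 𝓟

-- f involves only h₁, …, h_N.
InvolvesOnly : ℕ → Pred Polynomial 0ℓ
InvolvesOnly N f = ∀ m → coeff f m ≢ 0ℤ → All (_< N) m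

involvesOnly-exists : ∀ f → ∃ λ N → InvolvesOnly N f
involvesOnly-exists f = suc (max 0 indices) , λ m → occurs f m terms<N
  where
  indices : List ℕ
  indices = concat (map proj₂ f)

  terms<N : All (λ t → All (_< suc (max 0 indices)) (proj₂ t)) f
  terms<N = All.map⁻ (All.concat⁻ (All.map s≤s (xs≤max 0 indices)))

  occurs : ∀ {N} g m → All (λ t → All (_< N) (proj₂ t)) g →
           coeff g m ≢ 0ℤ → All (_< N) m
  occurs []      m []       nonzero = contradiction ≡.refl nonzero
  occurs (t ∷ g) m (b ∷ bs) nonzero with proj₂ t ≈ₘ? m
  ... | no  _  = occurs g m bs nonzero
  ... | yes eq = All-resp-↭ (sort-↭ m)
    (≡.subst (All (_< _)) eq (All-resp-↭ (↭-sym (sort-↭ (proj₂ t))) b))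

------------------------------------------------------------------------
-- Determinants and skew Schur functions

module _ (R : RawRing c ℓ) where
  open RawRing R
  open RawSemiringDefinitions rawSemiring using (sum; _^_)

  -- Laplace expansion along the first row.
  det : ∀ {n} → (Fin n → Fin n → Carrier) → Carrier
  det {zero}  M = 1#
  det {suc n} M = sum λ j →
    (- 1#) ^ toℕ j * M Fin.zero j * det (λ i → removeAt (M (Fin.suc i)) j)

skewSchur : SkewPartition → Polynomial
skewSchur s = det 𝓟 {ℓ[ outer s ]} λ i j →
  h (+ part (outer s) (toℕ i) ℤ.- + part (inner s) (toℕ j) ℤ.- + toℕ i ℤ.+ + toℕ j)

------------------------------------------------------------------------
-- Evaluation

module _ (R : RawRing c ℓ) where
  open RawRing R
  open RawSemiringDefinitions rawSemiring using () renaming (_×_ to _·_)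

  fromℤ : ℤ → Carrier
  fromℤ (+ n)    = n · 1#
  fromℤ -[1+ n ] = - (suc n · 1#)

  evalMonomial : (ℕ → Carrier) → Monomial → Carrier
  evalMonomial z m = foldr _*_ 1# (map z m)

  evalTerm : (ℕ → Carrier) → Term → Carrier
  evalTerm z (a , m) = fromℤ a * evalMonomial z m

  eval : (ℕ → Carrier) → Polynomial → Carrier
  eval z f = foldr _+_ 0# (map (evalTerm z) f)

  -- (z₁ , … , z_N) as values for all the variables, those beyond h_N being
  -- set to 0; the choice is immaterial for polynomials in h₁, …, h_N.
  assign : ∀ {N} → Vec Carrier N → ℕ → Carrier
  assign Vec.[]       _       = 0#
  assign (x Vec.∷ xs) zero    = x
  assign (x Vec.∷ xs) (suc i) = assign xs i

------------------------------------------------------------------------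
-- Finite fields and probabilities

-- A field with exactly q elements up to _≈_. The equality is then decidable
-- and the apartness of the Heyting field is its negation.
record FiniteField c ℓ₁ ℓ₂ (q : ℕ) : Set (lsuc (c ⊔ ℓ₁ ⊔ ℓ₂)) where
  field
    heytingField : HeytingField c ℓ₁ ℓ₂

  commutativeRing : CommutativeRing c ℓ₁
  commutativeRing = HeytingCommutativeRing.commutativeRing
    (HeytingField.heytingCommutativeRing heytingField)

  open CommutativeRing commutativeRing public

  field
    enumeration : Inverse setoid (≡.setoid (Fin q))

  open Inverse enumeration public using (to; from)

  _≟_ : Decidable _≈_
  _≟_ = via-injection (Inverse⇒Injection enumeration) Fin._≟_

  elements : List Carrier
  elements = map from (allFin q)

  tuples : ∀ N → List (Vec Carrier N)
  tuples zero    = Vec.[] ∷ []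
  tuples (suc N) = cartesianProductWith Vec._∷_ elements (tuples N)

  q≢0 : NonZero q
  q≢0 = nonZeroIndex (to 0#)

-- P(f ↦ a), computed with the variables h₁, …, h_N.
probability : ∀ {q} (F : FiniteField c ℓ₁ ℓ₂ q) →
              ℕ → Polynomial → FiniteField.Carrier F → ℚ
probability {q = q} F N f a =
  ((+ length (filter (λ z → eval rawRing (assign rawRing z) f ≟ a) (tuples N)))
    ℚ./ (q ℕ.^ N)) {{m^n≢0 q N {{q≢0}}}}
  where
  open FiniteField F

{-# OPTIONS --safe #-}
module Submission where

-- Let r and t be the first and the last nonempty row of λ/μ. Below the diagonal
-- the Jacobi–Trudi matrix vanishes, except for ones at (i + 1, i) for r ≤ i < t,
-- and the diagonal entries of the empty rows are ones. Hence the entry at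
-- (r, t), which is h_n with n the number of boxes, has cofactor ±1, and h_n
-- occurs in no other entry that contributes to the determinant. So
-- s_{λ/μ} = ±h_n + g with g free of h_n: whatever the other variables, exactly
-- one value of h_n yields a. That h_n is among h₁, …, h_N holds because its
-- coefficient is ±1, which the dual numbers over ℤ detect.

open import Defs
open import Algebra.Bundles using (CommutativeRing)
open import Algebra.Bundles.Raw using (RawRing)
import Algebra.Definitions.RawSemiring
import Algebra.Module.Construct.Idealization as Idealization
import Algebra.Module.Construct.TensorUnit as TensorUnit
import Algebra.Properties.AbelianGroup
import Algebra.Properties.CommutativeMonoid.Sum
import Algebra.Properties.CommutativeSemigroup
import Algebra.Properties.Ring
import Algebra.Properties.Semiring.Exp
import Algebra.Properties.Semiring.Mult
open import Data.Bool.Base using (if_then_else_)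
open import Data.Fin.Base as Fin using (Fin; toℕ; fromℕ<; punchIn)
open import Data.Fin.Properties as Fin using (toℕ-injective; toℕ-fromℕ<; suc-injective)
open import Data.Integer.Base as ℤ using (ℤ; +_; -[1+_]; 0ℤ; 1ℤ; _⊖_)
import Data.Integer.Properties as ℤ
open import Data.Integer.Tactic.RingSolver using (solve-∀)
open import Data.List.Base
  using (List; []; _∷_; [_]; _++_; map; length; filter; tabulate; allFin; cartesianProductWith)
open import Data.List.Properties
  using (length-++; length-map; length-tabulate; map-tabulate;
         filter-++; filter-accept; filter-reject; filter-none)
open import Data.List.Relation.Binary.Permutation.Propositional
  using (↭-sym; ↭-trans; ↭-reflexive)
open import Data.List.Relation.Binary.Permutation.Propositional.Properties
  using (↭-singleton-inv)
import Data.List.Relation.Unary.All as All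
import Data.List.Relation.Unary.All.Properties as All
open import Data.List.Relation.Unary.Linked using (Linked; []; [-]; _∷_)
open import Data.Nat.Base as ℕ
  using (ℕ; zero; suc; _≤_; _<_; _≥_; _∸_; NonZero; z≤n; s≤s; z<s; s<s; s≤s⁻¹; s<s⁻¹)
open import Data.Nat.Properties as ℕ using (≤-decTotalOrder)
open import Data.Nat.Tactic.RingSolver using () renaming (solve-∀ to ℕ-solve-∀)
open import Data.List.Sort ≤-decTotalOrder using (sort; sort-↭)
open import Data.Product.Base using (∃; _×_; _,_; proj₁; proj₂)
open import Data.Rational.Base using (_/_)
open import Data.Rational.Properties using (fromℚᵘ-cong)
open import Data.Rational.Unnormalised.Base using (mkℚᵘ; *≡*)
open import Data.Sum.Base as Sum using (_⊎_; inj₁; inj₂)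
open import Data.Vec.Base as Vec using (Vec; _[_]≔_)
open import Data.Vec.Functional using (removeAt)
open import Function.Base using (_∘_)
open import Function.Bundles using (_⇔_; mk⇔; Equivalence; Inverse)
open import Level using (Level; 0ℓ)
open import Relation.Binary.Construct.Closure.ReflexiveTransitive using (Star; ε; _◅_)
open import Relation.Binary.Definitions using (tri<; tri≈; tri>)
open import Relation.Binary.PropositionalEquality as ≡ using (_≡_; _≢_)
import Relation.Binary.Reasoning.Setoid
open import Relation.Nullary.Decidable using (dec-true; dec-false)
open import Relation.Nullary.Decidable.Core using (yes; no; does)
open import Relation.Nullary.Negation using (¬_; contradiction)
open import Relation.Unary using (Pred; Decidable; _∈_)

-- Determinants

-- The index of the entry at (i, j) is (λ_i - i) + (j - μ_j), strictly decreasing in i and strictly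
-- increasing in j. So among the rows from r on and the columns up to t it attains its maximum n
-- only at (r, t). Entries elsewhere may well equal h_n, but the block triangular form removes them
-- from the determinant. The polynomial g is never constructed. Two evaluations that differ only at
-- h_n are compared instead, and their difference is ± the difference of the two values of h_n. This
-- is proved over every commutative ring, so that one statement serves the finite field, where it
-- yields the unique solution, and the dual numbers, where it yields the coefficient. The dual
-- numbers bridge a gap between two notions: `InvolvesOnly` speaks of total coefficients, whereas
-- `eval` runs over a formal sum in which terms may cancel. Evaluation at infinitesimals respects
-- the ring operations and reads off a total coefficient.

punchIn-< : ∀ {n} (i : Fin (suc n)) (j : Fin n) → toℕ j < toℕ i → toℕ (punchIn i j) ≡ toℕ j
punchIn-< (Fin.suc i) Fin.zero    _   = ≡.refl
punchIn-< (Fin.suc i) (Fin.suc j) j<i = ≡.cong suc (punchIn-< i j (s<s⁻¹ j<i))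

punchIn-≥ : ∀ {n} (i : Fin (suc n)) (j : Fin n) → toℕ i ≤ toℕ j → toℕ (punchIn i j) ≡ suc (toℕ j)
punchIn-≥ Fin.zero    j           _   = ≡.refl
punchIn-≥ (Fin.suc i) (Fin.suc j) i≤j = ≡.cong suc (punchIn-≥ i j (s≤s⁻¹ i≤j))

punchIn-≤ : ∀ {n} (i : Fin (suc n)) (j : Fin n) → toℕ (punchIn i j) ≤ suc (toℕ j)
punchIn-≤ Fin.zero    j           = ℕ.≤-refl
punchIn-≤ (Fin.suc i) Fin.zero    = z≤n
punchIn-≤ (Fin.suc i) (Fin.suc j) = s≤s (punchIn-≤ i j)

module Determinant {c ℓ} (R : CommutativeRing c ℓ) where
  open CommutativeRing R
  open Algebra.Properties.CommutativeMonoid.Sum +-commutativeMonoid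
    using (sum; sum-cong-≋; sum-replicate-zero)
  open Algebra.Properties.Semiring.Exp semiring using (_^_)
  open Algebra.Properties.CommutativeSemigroup +-commutativeSemigroup
    using (xy∙z≈xz∙y; x∙yz≈y∙xz)
  open Relation.Binary.Reasoning.Setoid setoid

  Matrix : ℕ → Set c
  Matrix n = Fin n → Fin n → Carrier

  ∣_∣ : ∀ {n} → Matrix n → Carrier
  ∣ M ∣ = det rawRing M

  minor : ∀ {n} → Matrix (suc n) → Fin (suc n) → Matrix n
  minor M j i = removeAt (M (Fin.suc i)) j

  summand : ∀ {n} → Matrix (suc n) → Fin (suc n) → Carrier
  summand M j = (- 1#) ^ toℕ j * M Fin.zero j * ∣ minor M j ∣

  sum≈0 : ∀ {n} (f : Fin n → Carrier) → (∀ j → f j ≈ 0#) → sum f ≈ 0#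
  sum≈0 {n} f f≈0 = trans (sum-cong-≋ f≈0) (sum-replicate-zero n)

  entry≈0 : ∀ {x y z} → y ≈ 0# → x * y * z ≈ 0#
  entry≈0 {x} {y} {z} y≈0 = begin
    x * y * z  ≈⟨ *-congʳ (*-congˡ y≈0) ⟩
    x * 0# * z ≈⟨ *-congʳ (zeroʳ x) ⟩
    0# * z     ≈⟨ zeroˡ z ⟩
    0#         ∎

  minor≈0 : ∀ {x y z} → z ≈ 0# → x * y * z ≈ 0#
  minor≈0 z≈0 = trans (*-congˡ z≈0) (zeroʳ _)

  -- Frobenius–König: the dimensions of the block of zeros sum to n + 1.
  det-zeroBlock : ∀ {n} (M : Matrix n) p → p < n →
    (∀ i j → toℕ j ≤ p → p ≤ toℕ i → M i j ≈ 0#) → ∣ M ∣ ≈ 0#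
  det-zeroBlock {suc n} M zero    p<n M≈0 = sum≈0 (summand M) vanish
    where
    vanish : ∀ j → summand M j ≈ 0#
    vanish Fin.zero    = entry≈0 (M≈0 Fin.zero Fin.zero z≤n z≤n)
    vanish (Fin.suc {suc _} j) = minor≈0 (det-zeroBlock (minor M (Fin.suc j)) 0 z<s
      λ { i Fin.zero _ _ → M≈0 (Fin.suc i) Fin.zero z≤n z≤n })
  det-zeroBlock {suc n} M (suc p) p<n M≈0 = sum≈0 (summand M) λ j →
    minor≈0 (det-zeroBlock (minor M j) p (s<s⁻¹ p<n) λ i k k≤p p≤i →
      M≈0 (Fin.suc i) (punchIn j k) (ℕ.≤-trans (punchIn-≤ j k) (s≤s k≤p)) (s≤s p≤i))

  -- Deleting any column but the first keeps the zero part of the first column, so all minors but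
  -- one are singular.
  det-unitColumn : ∀ {n} (M : Matrix (suc n)) → M Fin.zero Fin.zero ≈ 1# →
    (∀ i → M (Fin.suc i) Fin.zero ≈ 0#) → ∣ M ∣ ≈ ∣ (λ i j → M (Fin.suc i) (Fin.suc j)) ∣
  det-unitColumn M M₀₀≈1 M≈0 = begin
    ∣ M ∣                                              ≈⟨ +-congˡ (sum≈0 _ (vanish M M≈0)) ⟩
    1# * M Fin.zero Fin.zero * ∣ minor M Fin.zero ∣ + 0# ≈⟨ +-identityʳ _ ⟩
    1# * M Fin.zero Fin.zero * ∣ minor M Fin.zero ∣      ≈⟨ *-congʳ (*-identityˡ _) ⟩
    M Fin.zero Fin.zero * ∣ minor M Fin.zero ∣           ≈⟨ *-congʳ M₀₀≈1 ⟩
    1# * ∣ minor M Fin.zero ∣                            ≈⟨ *-identityˡ _ ⟩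
    ∣ minor M Fin.zero ∣                                 ∎
    where
    vanish : ∀ {n} (M : Matrix (suc n)) → (∀ i → M (Fin.suc i) Fin.zero ≈ 0#) →
      ∀ j → summand M (Fin.suc j) ≈ 0#
    vanish {suc n} M M≈0 j = minor≈0 (det-zeroBlock (minor M (Fin.suc j)) 0 z<s
      λ { i Fin.zero _ _ → M≈0 i })

  det-unitriangular : ∀ {n} (M : Matrix n) →
    (∀ i j → toℕ j < toℕ i → M i j ≈ 0#) → (∀ i → M i i ≈ 1#) → ∣ M ∣ ≈ 1#
  det-unitriangular {zero}  M below diag = refl
  det-unitriangular {suc n} M below diag = trans
    (det-unitColumn M (diag Fin.zero) λ i → below (Fin.suc i) Fin.zero z<s)
    (det-unitriangular _ (λ i j j<i → below (Fin.suc i) (Fin.suc j) (s<s j<i)) (diag ∘ Fin.suc))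

  UnitriangularFrom : ∀ {n} → ℕ → Matrix n → Set ℓ
  UnitriangularFrom m M =
    (∀ i j → m ≤ toℕ i → toℕ j < toℕ i → M i j ≈ 0#) × (∀ i → m ≤ toℕ i → M i i ≈ 1#)

  -- The diagonal entries in the rows after m lie to the right of the deleted column, so both of
  -- their coordinates drop by one.
  minor-unitriangularFrom : ∀ {n m} {M : Matrix (suc n)} → UnitriangularFrom (suc m) M →
    ∀ j → toℕ j ≤ m → UnitriangularFrom m (minor M j)
  minor-unitriangularFrom {m = m} {M} (below , diag) j j≤m =
    (λ i k m≤i k<i → below (Fin.suc i) (punchIn j k) (s≤s m≤i)
      (ℕ.≤-<-trans (punchIn-≤ j k) (s<s k<i))) ,
    (λ i m≤i → ≡.subst (λ k → M (Fin.suc i) k ≈ 1#)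
      (≡.sym (toℕ-injective (punchIn-≥ j i (ℕ.≤-trans j≤m m≤i)))) (diag (Fin.suc i) (s≤s m≤i)))

  -- Columns 0 to j - 1 keep their places in the minor, and M vanishes in them from row j on. That
  -- row is row j - 1 of the minor, which makes the block of zeros large enough for `det-zeroBlock`.
  minor-singular : ∀ {n m} {M : Matrix (suc n)} → UnitriangularFrom m M →
    ∀ j → 0 < toℕ j → m ≤ toℕ j → ∣ minor M j ∣ ≈ 0#
  minor-singular {suc n} {M = M} (below , _) (Fin.suc j) _ m≤j =
    det-zeroBlock (minor M (Fin.suc j)) (toℕ j) (Fin.toℕ<n j) λ i k k≤j j≤i →
      below (Fin.suc i) (punchIn (Fin.suc j) k) (ℕ.≤-trans m≤j (s≤s j≤i))
        (≡.subst (_< suc (toℕ i)) (≡.sym (punchIn-< (Fin.suc j) k (s≤s k≤j)))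
          (s≤s (ℕ.≤-trans k≤j j≤i)))

  -- By the block triangular form, only the upper left m × m block counts. In the expansion along
  -- the first row, a column before m leaves a minor of the same form with m - 1 in place of m, and
  -- any later column leaves a singular one.
  det-unitriangularFrom : ∀ {n} m (M M′ : Matrix n) →
    UnitriangularFrom m M → UnitriangularFrom m M′ →
    (∀ i j → toℕ j < m → M i j ≈ M′ i j) → ∣ M ∣ ≈ ∣ M′ ∣
  det-unitriangularFrom {zero}  _ M M′ U U′ M≈M′ = refl
  det-unitriangularFrom {suc n} zero M M′ U U′ M≈M′ = trans
    (det-unitriangular M (λ i j → proj₁ U i j z≤n) (λ i → proj₂ U i z≤n))
    (sym (det-unitriangular M′ (λ i j → proj₁ U′ i j z≤n) (λ i → proj₂ U′ i z≤n)))
  det-unitriangularFrom {suc n} (suc m) M M′ U U′ M≈M′ = sum-cong-≋ agree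
    where
    agree : ∀ j → summand M j ≈ summand M′ j
    agree j with toℕ j ℕ.≤? m
    ... | yes j≤m = *-cong (*-congˡ (M≈M′ Fin.zero j (s≤s j≤m)))
      (det-unitriangularFrom m (minor M j) (minor M′ j)
        (minor-unitriangularFrom U j j≤m) (minor-unitriangularFrom U′ j j≤m)
        λ i k k<m → M≈M′ (Fin.suc i) (punchIn j k) (ℕ.≤-<-trans (punchIn-≤ j k) (s<s k<m)))
    ... | no j≰m = trans
      (minor≈0 (minor-singular {M = M} U j (ℕ.≤-<-trans z≤n (ℕ.≰⇒> j≰m)) (ℕ.≰⇒> j≰m)))
      (sym (minor≈0 (minor-singular {M = M′} U′ j (ℕ.≤-<-trans z≤n (ℕ.≰⇒> j≰m)) (ℕ.≰⇒> j≰m))))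

  -- Block upper triangular, with unitriangular blocks outside the rows r, …, t
  -- and, in these rows, a Hessenberg block whose subdiagonal consists of ones.
  record RibbonShape {n} (r t : ℕ) (M : Matrix n) : Set ℓ where
    field
      outside : ∀ i j → toℕ j < toℕ i → toℕ j < r ⊎ t < toℕ i → M i j ≈ 0#
      below   : ∀ i j → suc (toℕ j) < toℕ i → M i j ≈ 0#
      diag    : ∀ i → toℕ i < r ⊎ t < toℕ i → M i i ≈ 1#
      subdiag : ∀ i j → r ≤ toℕ j → toℕ j < t → toℕ i ≡ suc (toℕ j) → M i j ≈ 1#

  open RibbonShape

  ribbonShape-tail : ∀ {n r t} {M : Matrix (suc n)} → RibbonShape (suc r) (suc t) M →
    RibbonShape r t (λ i j → M (Fin.suc i) (Fin.suc j))
  ribbonShape-tail S = record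
    { outside = λ i j j<i →
        outside S (Fin.suc i) (Fin.suc j) (s<s j<i) ∘ Sum.map s<s s<s
    ; below   = λ i j j<i → below S (Fin.suc i) (Fin.suc j) (s<s j<i)
    ; diag    = λ i → diag S (Fin.suc i) ∘ Sum.map s<s s<s
    ; subdiag = λ i j r≤j j<t i≡1+j →
        subdiag S (Fin.suc i) (Fin.suc j) (s≤s r≤j) (s<s j<t) (≡.cong suc i≡1+j)
    }

  ribbonShape-unitriangularFrom : ∀ {n r t} {M : Matrix n} → RibbonShape r t M →
    UnitriangularFrom (suc t) M
  ribbonShape-unitriangularFrom S =
    (λ i j t<i j<i → outside S i j j<i (inj₂ t<i)) , (λ i t<i → diag S i (inj₂ t<i))

  -- The deletion moves the subdiagonal ones in the columns before t onto the diagonal, while the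
  -- diagonal ones after t stay on it.
  cornerMinor : ∀ {n} {M : Matrix (suc n)} (t : Fin (suc n)) → RibbonShape 0 (toℕ t) M →
    ∣ minor M t ∣ ≈ 1#
  cornerMinor {M = M} t S = det-unitriangular (minor M t) lower diagonal
    where
    lower : ∀ i j → toℕ j < toℕ i → minor M t i j ≈ 0#
    lower i j j<i with toℕ j ℕ.<? toℕ t
    ... | yes j<t = below S (Fin.suc i) (punchIn t j)
      (≡.subst (λ k → suc k < suc (toℕ i)) (≡.sym (punchIn-< t j j<t)) (s<s j<i))
    ... | no j≮t = outside S (Fin.suc i) (punchIn t j)
      (ℕ.≤-<-trans (punchIn-≤ t j) (s<s j<i))
      (inj₂ (ℕ.≤-<-trans (ℕ.≮⇒≥ j≮t) (ℕ.m<n⇒m<1+n j<i)))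

    diagonal : ∀ i → minor M t i i ≈ 1#
    diagonal i with toℕ i ℕ.<? toℕ t
    ... | yes i<t = subdiag S (Fin.suc i) (punchIn t i) z≤n
      (≡.subst (_< toℕ t) (≡.sym (punchIn-< t i i<t)) i<t)
      (≡.cong suc (≡.sym (punchIn-< t i i<t)))
    ... | no i≮t = ≡.subst (λ k → M (Fin.suc i) k ≈ 1#)
      (≡.sym (toℕ-injective (punchIn-≥ t i (ℕ.≮⇒≥ i≮t))))
      (diag S (Fin.suc i) (inj₂ (s≤s (ℕ.≮⇒≥ i≮t))))

  sum-change : ∀ {n} (f g : Fin n → Carrier) t {d} → (∀ j → j ≢ t → f j ≈ g j) →
    f t ≈ g t + d → sum f ≈ sum g + d
  sum-change f g Fin.zero {d} f≈g ft≈gt+d = begin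
    f Fin.zero + sum (f ∘ Fin.suc)
      ≈⟨ +-cong ft≈gt+d (sum-cong-≋ λ j → f≈g (Fin.suc j) λ ()) ⟩
    g Fin.zero + d + sum (g ∘ Fin.suc)
      ≈⟨ xy∙z≈xz∙y _ _ _ ⟩
    g Fin.zero + sum (g ∘ Fin.suc) + d
      ∎
  sum-change f g (Fin.suc t) {d} f≈g ft≈gt+d = begin
    f Fin.zero + sum (f ∘ Fin.suc)
      ≈⟨ +-cong (f≈g Fin.zero λ ()) (sum-change (f ∘ Fin.suc) (g ∘ Fin.suc) t
           (λ j j≢t → f≈g (Fin.suc j) (j≢t ∘ Fin.suc-injective)) ft≈gt+d) ⟩
    g Fin.zero + (sum (g ∘ Fin.suc) + d)
      ≈⟨ +-assoc _ _ _ ⟨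
    g Fin.zero + sum (g ∘ Fin.suc) + d
      ∎

  -- For r = 0, expand along the first row: the corner has a sign as cofactor, the minors of the
  -- columns before t depend on no column after t, and those of the columns after t are singular.
  -- For larger r, the leading unit columns are peeled off. Agreement is not asked for above row r
  -- or right of column t, where the changed variable may occur as well.
  det-cornerChange : ∀ {n} (r t : Fin n) (M M′ : Matrix n) → toℕ r ≤ toℕ t →
    RibbonShape (toℕ r) (toℕ t) M → RibbonShape (toℕ r) (toℕ t) M′ →
    (∀ i j → toℕ r < toℕ i → toℕ j ≤ toℕ t → M i j ≈ M′ i j) →
    (∀ j → toℕ j < toℕ t → M r j ≈ M′ r j) →
    ∣ M ∣ ≈ ∣ M′ ∣ + (- 1#) ^ (toℕ t ∸ toℕ r) * (M r t - M′ r t)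
  det-cornerChange Fin.zero t M M′ _ S S′ lowerRows firstRow =
    sum-change (summand M) (summand M′) t agree corner
    where
    sgn = (- 1#) ^ toℕ t

    agree : ∀ j → j ≢ t → summand M j ≈ summand M′ j
    agree j j≢t with ℕ.<-cmp (toℕ j) (toℕ t)
    ... | tri< j<t _ _ = *-cong (*-congˡ (firstRow j j<t))
      (det-unitriangularFrom (toℕ t) (minor M j) (minor M′ j)
        (minor-unitriangularFrom (ribbonShape-unitriangularFrom S) j (ℕ.<⇒≤ j<t))
        (minor-unitriangularFrom (ribbonShape-unitriangularFrom S′) j (ℕ.<⇒≤ j<t))
        λ i k k<t → lowerRows (Fin.suc i) (punchIn j k) z<s (ℕ.≤-trans (punchIn-≤ j k) k<t))
    ... | tri≈ _ j≡t _ = contradiction (toℕ-injective j≡t) j≢t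
    ... | tri> _ _ t<j = trans
      (minor≈0 (minor-singular {M = M} (ribbonShape-unitriangularFrom S) j
        (ℕ.≤-<-trans z≤n t<j) t<j))
      (sym (minor≈0 (minor-singular {M = M′} (ribbonShape-unitriangularFrom S′) j
        (ℕ.≤-<-trans z≤n t<j) t<j)))

    corner : summand M t ≈ summand M′ t + sgn * (M Fin.zero t - M′ Fin.zero t)
    corner = begin
      sgn * M Fin.zero t * ∣ minor M t ∣
        ≈⟨ *-congˡ (cornerMinor {M = M} t S) ⟩
      sgn * M Fin.zero t * 1#
        ≈⟨ *-identityʳ _ ⟩
      sgn * M Fin.zero t
        ≈⟨ *-congˡ (+-identityʳ _) ⟨
      sgn * (M Fin.zero t + 0#)
        ≈⟨ *-congˡ (+-congˡ (-‿inverseʳ _)) ⟨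
      sgn * (M Fin.zero t + (M′ Fin.zero t - M′ Fin.zero t))
        ≈⟨ *-congˡ (x∙yz≈y∙xz _ _ _) ⟩
      sgn * (M′ Fin.zero t + (M Fin.zero t - M′ Fin.zero t))
        ≈⟨ distribˡ _ _ _ ⟩
      sgn * M′ Fin.zero t + sgn * (M Fin.zero t - M′ Fin.zero t)
        ≈⟨ +-congʳ (*-identityʳ _) ⟨
      sgn * M′ Fin.zero t * 1# + sgn * (M Fin.zero t - M′ Fin.zero t)
        ≈⟨ +-congʳ (*-congˡ (cornerMinor {M = M′} t S′)) ⟨
      sgn * M′ Fin.zero t * ∣ minor M′ t ∣ + sgn * (M Fin.zero t - M′ Fin.zero t)
        ∎
  det-cornerChange (Fin.suc r) (Fin.suc t) M M′ r≤t S S′ lowerRows firstRow = begin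
    ∣ M ∣
      ≈⟨ dropHead M S ⟩
    ∣ (λ i j → M (Fin.suc i) (Fin.suc j)) ∣
      ≈⟨ det-cornerChange r t _ _ (s≤s⁻¹ r≤t) (ribbonShape-tail S) (ribbonShape-tail S′)
           (λ i j r<i j≤t → lowerRows (Fin.suc i) (Fin.suc j) (s<s r<i) (s≤s j≤t))
           (λ j j<t → firstRow (Fin.suc j) (s<s j<t)) ⟩
    ∣ (λ i j → M′ (Fin.suc i) (Fin.suc j)) ∣ + _
      ≈⟨ +-congʳ (dropHead M′ S′) ⟨
    ∣ M′ ∣ + _
      ∎
    where
    dropHead : ∀ N → RibbonShape (suc (toℕ r)) (suc (toℕ t)) N →
      ∣ N ∣ ≈ ∣ (λ i j → N (Fin.suc i) (Fin.suc j)) ∣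
    dropHead N T = det-unitColumn N (diag T Fin.zero (inj₁ z<s))
      λ i → outside T (Fin.suc i) Fin.zero z<s (inj₁ z<s)

-- Evaluation as a ring homomorphism

module Evaluation {c ℓ} (R : CommutativeRing c ℓ) where
  open CommutativeRing R
  open Algebra.Properties.CommutativeMonoid.Sum +-commutativeMonoid
    using (sum; sum-cong-≋)
  open Algebra.Properties.Semiring.Exp semiring using (_^_)
  open Algebra.Properties.Semiring.Mult semiring using (×1-homo-*)
  open Algebra.Properties.Ring ring
    using (-‿distribˡ-*; -‿distribʳ-*; -‿involutive; -‿+-comm; -0#≈0#)
  open Algebra.Properties.CommutativeSemigroup *-commutativeSemigroup using (interchange)
  open Relation.Binary.Reasoning.Setoid setoid
  private
    module 𝓟 = RawRing 𝓟
    module P = Algebra.Definitions.RawSemiring 𝓟.rawSemiring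

  fromℤ-neg : ∀ a → fromℤ rawRing (ℤ.- a) ≈ - fromℤ rawRing a
  fromℤ-neg (+ zero)  = sym -0#≈0#
  fromℤ-neg (+ suc n) = refl
  fromℤ-neg -[1+ n ]  = sym (-‿involutive _)

  fromℤ-*₊ : ∀ m b → fromℤ rawRing (+ m ℤ.* b) ≈ fromℤ rawRing (+ m) * fromℤ rawRing b
  fromℤ-*₊ m (+ n)    = trans
    (reflexive (≡.cong (fromℤ rawRing) (≡.sym (ℤ.pos-* m n)))) (×1-homo-* m n)
  fromℤ-*₊ m -[1+ n ] = begin
    fromℤ rawRing (+ m ℤ.* -[1+ n ])
      ≡⟨ ≡.cong (fromℤ rawRing) (ℤ.neg-distribʳ-* (+ m) (+ suc n)) ⟨
    fromℤ rawRing (ℤ.- (+ m ℤ.* + suc n))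
      ≈⟨ fromℤ-neg (+ m ℤ.* + suc n) ⟩
    - fromℤ rawRing (+ m ℤ.* + suc n)
      ≈⟨ -‿cong (fromℤ-*₊ m (+ suc n)) ⟩
    - (fromℤ rawRing (+ m) * fromℤ rawRing (+ suc n))
      ≈⟨ -‿distribʳ-* _ _ ⟩
    fromℤ rawRing (+ m) * fromℤ rawRing -[1+ n ]
      ∎

  fromℤ-* : ∀ a b → fromℤ rawRing (a ℤ.* b) ≈ fromℤ rawRing a * fromℤ rawRing b
  fromℤ-* (+ m)    b = fromℤ-*₊ m b
  fromℤ-* -[1+ m ] b = begin
    fromℤ rawRing (-[1+ m ] ℤ.* b)
      ≡⟨ ≡.cong (fromℤ rawRing) (ℤ.neg-distribˡ-* (+ suc m) b) ⟨
    fromℤ rawRing (ℤ.- (+ suc m ℤ.* b))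
      ≈⟨ fromℤ-neg (+ suc m ℤ.* b) ⟩
    - fromℤ rawRing (+ suc m ℤ.* b)
      ≈⟨ -‿cong (fromℤ-*₊ (suc m) b) ⟩
    - (fromℤ rawRing (+ suc m) * fromℤ rawRing b)
      ≈⟨ -‿distribˡ-* _ _ ⟩
    fromℤ rawRing -[1+ m ] * fromℤ rawRing b
      ∎

  fromℤ-1 : fromℤ rawRing 1ℤ ≈ 1#
  fromℤ-1 = +-identityʳ 1#

  module _ (z : ℕ → Carrier) where
    evalMonomial-++ : ∀ m n →
      evalMonomial rawRing z (m ++ n) ≈ evalMonomial rawRing z m * evalMonomial rawRing z n
    evalMonomial-++ []      n = sym (*-identityˡ _)
    evalMonomial-++ (i ∷ m) n = trans (*-congˡ (evalMonomial-++ m n)) (sym (*-assoc _ _ _))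

    evalTerm-* : ∀ s t →
      evalTerm rawRing z (mulTerm s t) ≈ evalTerm rawRing z s * evalTerm rawRing z t
    evalTerm-* (a , m) (b , n) =
      trans (*-cong (fromℤ-* a b) (evalMonomial-++ m n)) (interchange _ _ _ _)

    eval-+ : ∀ f g → eval rawRing z (f 𝓟.+ g) ≈ eval rawRing z f + eval rawRing z g
    eval-+ []      g = sym (+-identityˡ _)
    eval-+ (t ∷ f) g = trans (+-congˡ (eval-+ f g)) (sym (+-assoc _ _ _))

    eval-mulTerm : ∀ t g →
      eval rawRing z (map (mulTerm t) g) ≈ evalTerm rawRing z t * eval rawRing z g
    eval-mulTerm t []      = sym (zeroʳ _)
    eval-mulTerm t (u ∷ g) =
      trans (+-cong (evalTerm-* t u) (eval-mulTerm t g)) (sym (distribˡ _ _ _))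

    eval-* : ∀ f g → eval rawRing z (f 𝓟.* g) ≈ eval rawRing z f * eval rawRing z g
    eval-* []      g = sym (zeroˡ _)
    eval-* (t ∷ f) g = begin
      eval rawRing z (map (mulTerm t) g ++ f 𝓟.* g)
        ≈⟨ eval-+ (map (mulTerm t) g) (f 𝓟.* g) ⟩
      eval rawRing z (map (mulTerm t) g) + eval rawRing z (f 𝓟.* g)
        ≈⟨ +-cong (eval-mulTerm t g) (eval-* f g) ⟩
      evalTerm rawRing z t * eval rawRing z g + eval rawRing z f * eval rawRing z g
        ≈⟨ distribʳ _ _ _ ⟨
      eval rawRing z (t ∷ f) * eval rawRing z g
        ∎

    eval-neg : ∀ f → eval rawRing z (𝓟.- f) ≈ - eval rawRing z f
    eval-neg []            = sym -0#≈0#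
    eval-neg ((a , m) ∷ f) = trans
      (+-cong (trans (*-congʳ (fromℤ-neg a)) (sym (-‿distribˡ-* _ _))) (eval-neg f))
      (-‿+-comm _ _)

    eval-1 : eval rawRing z 𝓟.1# ≈ 1#
    eval-1 = trans (+-identityʳ _) (trans (*-identityʳ _) fromℤ-1)

    eval-sum : ∀ {n} (f : Fin n → Polynomial) →
      eval rawRing z (P.sum f) ≈ sum (eval rawRing z ∘ f)
    eval-sum {zero}  f = refl
    eval-sum {suc n} f =
      trans (eval-+ (f Fin.zero) (P.sum (f ∘ Fin.suc))) (+-congˡ (eval-sum (f ∘ Fin.suc)))

    eval-sign : ∀ n → eval rawRing z ((𝓟.- 𝓟.1#) P.^ n) ≈ (- 1#) ^ n
    eval-sign zero    = eval-1
    eval-sign (suc n) = trans (eval-* (𝓟.- 𝓟.1#) ((𝓟.- 𝓟.1#) P.^ n))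
      (*-cong (trans (eval-neg 𝓟.1#) (-‿cong eval-1)) (eval-sign n))

    -- `𝓟` is only a raw ring. Evaluation carries the Laplace expansion over to R term by term, and
    -- the determinant identities are applied there.
    eval-det : ∀ {n} (M : Fin n → Fin n → Polynomial) →
      eval rawRing z (det 𝓟 M) ≈ det rawRing (λ i j → eval rawRing z (M i j))
    eval-det {zero}  M = eval-1
    eval-det {suc n} M =
      trans (eval-sum λ j → sign j 𝓟.* M Fin.zero j 𝓟.* minor j) (sum-cong-≋ term)
      where
      sign minor : Fin (suc n) → Polynomial
      sign j  = (𝓟.- 𝓟.1#) P.^ toℕ j
      minor j = det 𝓟 (λ i → removeAt (M (Fin.suc i)) j)

      term : ∀ j → eval rawRing z (sign j 𝓟.* M Fin.zero j 𝓟.* minor j) ≈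
        (- 1#) ^ toℕ j * eval rawRing z (M Fin.zero j) *
          det rawRing (λ i → removeAt (λ k → eval rawRing z (M (Fin.suc i) k)) j)
      term j = begin
        eval rawRing z (sign j 𝓟.* M Fin.zero j 𝓟.* minor j)
          ≈⟨ eval-* (sign j 𝓟.* M Fin.zero j) (minor j) ⟩
        eval rawRing z (sign j 𝓟.* M Fin.zero j) * eval rawRing z (minor j)
          ≈⟨ *-cong (trans (eval-* (sign j) (M Fin.zero j)) (*-congʳ (eval-sign (toℕ j))))
                    (eval-det (λ i → removeAt (M (Fin.suc i)) j)) ⟩
        (- 1#) ^ toℕ j * eval rawRing z (M Fin.zero j) *
          det rawRing (λ i → removeAt (λ k → eval rawRing z (M (Fin.suc i) k)) j)
          ∎

    eval-h-0 : eval rawRing z (h (+ 0)) ≈ 1#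
    eval-h-0 = eval-1

    eval-h-suc : ∀ k → eval rawRing z (h (+ suc k)) ≈ z k
    eval-h-suc k = begin
      fromℤ rawRing 1ℤ * (z k * 1#) + 0# ≈⟨ +-identityʳ _ ⟩
      fromℤ rawRing 1ℤ * (z k * 1#)      ≈⟨ *-cong fromℤ-1 (*-identityʳ _) ⟩
      1# * z k                           ≈⟨ *-identityˡ _ ⟩
      z k                                ∎

  eval-h-cong : ∀ {z z′ k} → (∀ i → i ≢ k → z i ≈ z′ i) → ∀ d → d ≢ + suc k →
    eval rawRing z (h d) ≈ eval rawRing z′ (h d)
  eval-h-cong             agree (+ zero)  d≢ = refl
  eval-h-cong {z} {z′} agree (+ suc i) d≢ = trans (eval-h-suc z i)
    (trans (agree i (d≢ ∘ ≡.cong (+_ ∘ suc))) (sym (eval-h-suc z′ i)))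
  eval-h-cong             agree -[1+ n ]  d≢ = refl

-- Ribbons and the Jacobi–Trudi matrix

least : ∀ {P : Pred ℕ 0ℓ} → Decidable P → ∀ n → P n →
  ∃ λ r → r ≤ n × P r × (∀ i → i < r → ¬ P i)
least P? n Pn with P? 0
least P? n       Pn | yes P0 = 0 , z≤n , P0 , λ _ ()
least P? zero    Pn | no ¬P0 = contradiction Pn ¬P0
least P? (suc n) Pn | no ¬P0 with least (P? ∘ suc) n Pn
... | r , r≤n , Pr , below = suc r , s≤s r≤n , Pr ,
  λ { zero _ → ¬P0 ; (suc i) i<r → below i (s<s⁻¹ i<r) }

greatest : ∀ {P : Pred ℕ 0ℓ} → Decidable P → ∀ m → (∀ i → m ≤ i → ¬ P i) → ∀ n → P n →
  ∃ λ t → n ≤ t × P t × (∀ i → t < i → ¬ P i)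
greatest P? zero    ¬P n Pn = contradiction Pn (¬P n z≤n)
greatest {P} P? (suc m) ¬P n Pn with P? m
... | yes Pm = m , ℕ.≮⇒≥ (λ m<n → ¬P n m<n Pn) , Pm , ¬P
... | no ¬Pm = greatest P? m bound n Pn
  where
  bound : ∀ i → m ≤ i → ¬ P i
  bound i m≤i with ℕ.m≤n⇒m<n∨m≡n m≤i
  ... | inj₁ m<i    = ¬P i m<i
  ... | inj₂ ≡.refl = ¬Pm

nth-suc : ∀ {xs} → Linked _≥_ xs → ∀ i → nth xs (suc i) ≤ nth xs i
nth-suc []          i       = z≤n
nth-suc [-]         zero    = z≤n
nth-suc [-]         (suc i) = z≤n
nth-suc (x≥y ∷ _)   zero    = x≥y
nth-suc (_   ∷ xs≥) (suc i) = nth-suc xs≥ i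

part-antitone : ∀ p {i j} → i ≤ j → part p j ≤ part p i
part-antitone p {i} {zero}  z≤n = ℕ.≤-refl
part-antitone p {i} {suc j} i≤1+j with ℕ.m≤n⇒m<n∨m≡n i≤1+j
... | inj₁ i<1+j  = ℕ.≤-trans (nth-suc (Partition.decreasing p) j) (part-antitone p (s≤s⁻¹ i<1+j))
... | inj₂ ≡.refl = ℕ.≤-refl

nth≥length : ∀ xs i → length xs ≤ i → nth xs i ≡ 0
nth≥length []       i       _   = ≡.refl
nth≥length (x ∷ xs) (suc i) l≤i = nth≥length xs i (s≤s⁻¹ l≤i)

<nth⇒<length : ∀ xs {i j} → j < nth xs i → i < length xs
<nth⇒<length xs {i} {j} j<x =
  ℕ.≰⇒> λ l≤i → ℕ.n≮0 (≡.subst (j <_) (nth≥length xs i l≤i) j<x)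

module _ (s : SkewPartition) where
  private
    D  = SkewDiagram s
    ℓλ = ℓ[ outer s ]

    lam mu : ℕ → ℕ
    lam = part (outer s)
    mu  = part (inner s)

    mu≤lam : ∀ i → mu i ≤ lam i
    mu≤lam = SkewPartition.inner≤outer s

  skewDiagram⁺ : ∀ {i j} → mu i ≤ j → j < lam i → (i , j) ∈ D
  skewDiagram⁺ mu≤j j<lam =
    (<nth⇒<length (parts (outer s)) j<lam , j<lam) , λ (_ , j<mu) → ℕ.<⇒≱ j<mu mu≤j

  skewDiagram⁻ : ∀ {i j} → (i , j) ∈ D → mu i ≤ j × j < lam i
  skewDiagram⁻ ((_ , j<lam) , ∉inner) =
    ℕ.≮⇒≥ (λ j<mu → ∉inner (<nth⇒<length (parts (inner s)) j<mu , j<mu)) , j<lam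

  -- The ribbon condition in numbers. Rows i and i + 1 share the columns from `mu i` up to, but
  -- excluding, `lam (suc i)`; `overlaps` says that this is a single column.
  record RibbonRows : Set where
    field
      r t       : Fin ℓλ
      r≤t       : toℕ r ≤ toℕ t
      nonempty  : mu (toℕ t) < lam (toℕ t)
      emptyRows : ∀ i → i < toℕ r ⊎ toℕ t < i → lam i ≡ mu i
      overlaps   : ∀ i → toℕ r ≤ i → i < toℕ t → lam (suc i) ≡ suc (mu i)

  private
    adjacent-rows : ∀ {i i′ j j′} → i < i′ → Adjacent (i , j) (i′ , j′) → i′ ≡ suc i × j ≡ j′
    adjacent-rows {i} {i′} {j} {j′} i<i′ adj
      with ℕ.∣ i - i′ ∣ in eq
    ... | zero        = contradiction (ℕ.∣m-n∣≡0⇒m≡n eq) (ℕ.<⇒≢ i<i′)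
    ... | suc zero    =
      ≡.trans (≡.sym (ℕ.m∸n+n≡m (ℕ.<⇒≤ i<i′)))
        (≡.cong (ℕ._+ i) (≡.trans (≡.sym (ℕ.m≤n⇒∣m-n∣≡n∸m (ℕ.<⇒≤ i<i′))) eq)) ,
      ℕ.∣m-n∣≡0⇒m≡n (ℕ.suc-injective adj)
    ... | suc (suc _) with () ← adj

    -- A discrete intermediate value argument: the row changes by at most one per step, so the first
    -- step beyond row i starts in row i, and a step between rows keeps its column.
    crossing : ∀ {b b′} i → Star (Step D) b b′ → proj₁ b ≤ i → i < proj₁ b′ →
      ∃ λ j → (i , j) ∈ D × (suc i , j) ∈ D
    crossing i ε b≤i i<b′ = contradiction (ℕ.<-≤-trans i<b′ b≤i) (ℕ.<-irrefl ≡.refl)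
    crossing {_ , j} i (_◅_ {j = c , j′} (b∈D , c∈D , adj) path) b≤i i<b′ with c ℕ.≤? i
    ... | yes c≤i = crossing i path c≤i i<b′
    ... | no c≰i with adjacent-rows {j = j} {j′} (ℕ.≤-<-trans b≤i (ℕ.≰⇒> c≰i)) adj
    ...   | ≡.refl , ≡.refl with ℕ.≤-antisym b≤i (s≤s⁻¹ (ℕ.≰⇒> c≰i))
    ...     | ≡.refl = j , b∈D , c∈D

  ribbonRows : Ribbon s → RibbonRows
  ribbonRows ((((i₀ , j₀) , b₀) , connected) , ¬2×2) = record
    { r         = fromℕ< r<ℓ
    ; t         = fromℕ< t<ℓ
    ; r≤t       = ≡.subst₂ _≤_ (≡.sym r≡) (≡.sym t≡) (ℕ.≤-trans r≤i₀ i₀≤t)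
    ; nonempty  = ≡.subst Nonempty (≡.sym t≡) t-nonempty
    ; emptyRows = λ
        { i (inj₁ i<r) → empty (r-least i (≡.subst (i <_) r≡ i<r))
        ; i (inj₂ t<i) → empty (t-greatest i (≡.subst (_< i) t≡ t<i)) }
    ; overlaps   = λ i r≤i i<t →
        single i (≡.subst (_≤ i) r≡ r≤i) (≡.subst (i <_) t≡ i<t)
    }
    where
    Nonempty : Pred ℕ 0ℓ
    Nonempty i = mu i < lam i

    nonempty? : Decidable Nonempty
    nonempty? i = mu i ℕ.<? lam i

    nonempty⇒<ℓ : ∀ {i} → Nonempty i → i < ℓλ
    nonempty⇒<ℓ = <nth⇒<length (parts (outer s))

    empty : ∀ {i} → ¬ Nonempty i → lam i ≡ mu i
    empty {i} mu≮lam = ℕ.≤-antisym (ℕ.≮⇒≥ mu≮lam) (mu≤lam i)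

    i₀-nonempty : Nonempty i₀
    i₀-nonempty = let mu≤j , j<lam = skewDiagram⁻ b₀ in ℕ.≤-<-trans mu≤j j<lam

    first = least nonempty? i₀ i₀-nonempty
    last  = greatest nonempty? ℓλ (λ i ℓ≤i i-nonempty → ℕ.<⇒≱ (nonempty⇒<ℓ i-nonempty) ℓ≤i)
      i₀ i₀-nonempty

    r = proj₁ first
    t = proj₁ last
    r≤i₀       = proj₁ (proj₂ first)
    r-nonempty = proj₁ (proj₂ (proj₂ first))
    r-least    = proj₂ (proj₂ (proj₂ first))
    i₀≤t       = proj₁ (proj₂ last)
    t-nonempty = proj₁ (proj₂ (proj₂ last))
    t-greatest = proj₂ (proj₂ (proj₂ last))

    r<ℓ = nonempty⇒<ℓ r-nonempty
    t<ℓ = nonempty⇒<ℓ t-nonempty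
    r≡  = toℕ-fromℕ< r<ℓ
    t≡  = toℕ-fromℕ< t<ℓ

    single : ∀ i → r ≤ i → i < t → lam (suc i) ≡ suc (mu i)
    single i r≤i i<t = ℕ.≤-antisym (ℕ.≮⇒≥ tooWide) atLeast
      where
      -- Connectedness gives a column common to rows i and i + 1.
      atLeast : mu i < lam (suc i)
      atLeast =
        let path = connected {r , mu r} {t , mu t}
              (skewDiagram⁺ ℕ.≤-refl r-nonempty) (skewDiagram⁺ ℕ.≤-refl t-nonempty)
            j , above , below = crossing i path r≤i i<t
        in ℕ.≤-<-trans (proj₁ (skewDiagram⁻ above)) (proj₂ (skewDiagram⁻ below))

      -- Otherwise both rows contain the columns `mu i` and `mu i + 1`, which form a 2 × 2 block.
      tooWide : ¬ suc (mu i) < lam (suc i)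
      tooWide wide = ¬2×2 (i , mu i ,
        skewDiagram⁺ ℕ.≤-refl (ℕ.<-≤-trans atLeast lam≤) ,
        skewDiagram⁺ (ℕ.n≤1+n _) (ℕ.<-≤-trans wide lam≤) ,
        skewDiagram⁺ mu≤ atLeast ,
        skewDiagram⁺ (ℕ.m≤n⇒m≤1+n mu≤) wide)
        where
        lam≤ = part-antitone (outer s) (ℕ.n≤1+n i)
        mu≤  = part-antitone (inner s) (ℕ.n≤1+n i)

  index : ℕ → ℕ → ℤ
  index i j = + lam i ℤ.- + mu j ℤ.- + i ℤ.+ + j

  -- As a difference of two naturals, the index can be tested for being negative, zero or n by
  -- comparisons in ℕ.
  index≡⊖ : ∀ i j → index i j ≡ (lam i ℕ.+ j) ⊖ (mu j ℕ.+ i)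
  index≡⊖ i j = ≡.trans (rearrange (+ lam i) (+ mu j) (+ i) (+ j))
    (ℤ.m-n≡m⊖n (lam i ℕ.+ j) (mu j ℕ.+ i))
    where
    rearrange : ∀ a b c d → a ℤ.- b ℤ.- c ℤ.+ d ≡ (a ℤ.+ d) ℤ.- (b ℤ.+ c)
    rearrange = solve-∀

⊖-negative : ∀ {m n} → m < n → ∃ λ d → m ⊖ n ≡ -[1+ d ]
⊖-negative {m} {n} m<n with n ∸ m | ℕ.m<n⇒0<n∸m m<n | ℤ.⊖-< m<n
... | suc d | _ | eq = d , eq

⊖≢ : ∀ {m n k} → m < n ℕ.+ suc k → m ⊖ n ≢ + suc k
⊖≢ {m} {n} {k} m< eq with m ℕ.<? n
... | yes m<n with () ← ≡.trans (≡.sym (proj₂ (⊖-negative m<n))) eq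
... | no m≮n = ℕ.<⇒≢ m< (≡.trans (≡.sym (ℕ.m+[n∸m]≡n n≤m))
    (≡.cong (n ℕ.+_) (ℤ.+-injective (≡.trans (≡.sym (ℤ.⊖-≥ n≤m)) eq))))
  where n≤m = ℕ.≮⇒≥ m≮n

⊖≡ : ∀ {m} n d → m ≡ n ℕ.+ d → m ⊖ n ≡ + d
⊖≡ n d ≡.refl = ≡.trans (ℤ.⊖-≥ (ℕ.m≤m+n n d)) (≡.cong +_ (ℕ.m+n∸m≡n n d))

module _ (s : SkewPartition) (rows : RibbonRows s) where
  open RibbonRows rows
  private
    lam mu : ℕ → ℕ
    lam = part (outer s)
    mu  = part (inner s)

    lam≤ : ∀ {i j} → i ≤ j → lam j ≤ lam i
    lam≤ = part-antitone (outer s)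

    mu≤ : ∀ {i j} → i ≤ j → mu j ≤ mu i
    mu≤ = part-antitone (inner s)

    corner< : mu (toℕ t) ℕ.+ toℕ r < lam (toℕ r) ℕ.+ toℕ t
    corner< = ℕ.+-mono-<-≤ (ℕ.<-≤-trans nonempty (lam≤ r≤t)) r≤t

  -- The corner entry of the Jacobi–Trudi matrix is the variable with this index,
  -- that is h_n with n = top + 1 the number of boxes of the ribbon.
  top : ℕ
  top = lam (toℕ r) ℕ.+ toℕ t ∸ suc (mu (toℕ t) ℕ.+ toℕ r)

  private
    corner≡ : lam (toℕ r) ℕ.+ toℕ t ≡ mu (toℕ t) ℕ.+ toℕ r ℕ.+ suc top
    corner≡ = ≡.trans (≡.sym (ℕ.m+[n∸m]≡n corner<)) (≡.sym (ℕ.+-suc _ top))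

    -- In an empty row `lam` and `mu` coincide, so by monotonicity `lam i ≤ mu j`, and the index is
    -- at most j - i < 0.
    index-outside : ∀ {i j} → j < i → j < toℕ r ⊎ toℕ t < i → lam i ℕ.+ j < mu j ℕ.+ i
    index-outside {i} {j} j<i (inj₁ j<r) =
      ℕ.+-mono-≤-< (ℕ.≤-trans (lam≤ (ℕ.<⇒≤ j<i)) (ℕ.≤-reflexive (emptyRows j (inj₁ j<r)))) j<i
    index-outside {i} {j} j<i (inj₂ t<i) =
      ℕ.+-mono-≤-< (ℕ.≤-trans (ℕ.≤-reflexive (emptyRows i (inj₂ t<i))) (mu≤ (ℕ.<⇒≤ j<i))) j<i

    -- Within the rows of the ribbon, `lam i ≤ lam (suc j)`, which is `mu j + 1` by the overlap. So
    -- the index is at most j + 1 - i, negative from two places below the diagonal on.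
    index-below : ∀ {i j} → suc j < i → lam i ℕ.+ j < mu j ℕ.+ i
    index-below {i} {j} 1+j<i with j ℕ.<? toℕ r | toℕ t ℕ.<? i
    ... | yes j<r | _       = index-outside (ℕ.<-trans (ℕ.n<1+n j) 1+j<i) (inj₁ j<r)
    ... | no  _   | yes t<i = index-outside (ℕ.<-trans (ℕ.n<1+n j) 1+j<i) (inj₂ t<i)
    ... | no j≮r  | no t≮i  = begin-strict
      lam i ℕ.+ j       ≤⟨ ℕ.+-monoˡ-≤ j (lam≤ (ℕ.<⇒≤ 1+j<i)) ⟩
      lam (suc j) ℕ.+ j ≡⟨ ≡.cong (ℕ._+ j) (overlaps j (ℕ.≮⇒≥ j≮r)
                             (ℕ.<-≤-trans (ℕ.<-trans (ℕ.n<1+n j) 1+j<i) (ℕ.≮⇒≥ t≮i))) ⟩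
      suc (mu j ℕ.+ j)  ≡⟨ ℕ.+-suc (mu j) j ⟨
      mu j ℕ.+ suc j    <⟨ ℕ.+-monoʳ-< (mu j) 1+j<i ⟩
      mu j ℕ.+ i        ∎
      where open ℕ.≤-Reasoning

    index-subdiag : ∀ {j} → toℕ r ≤ j → j < toℕ t → lam (suc j) ℕ.+ j ≡ mu j ℕ.+ suc j
    index-subdiag {j} r≤j j<t =
      ≡.trans (≡.cong (ℕ._+ j) (overlaps j r≤j j<t)) (≡.sym (ℕ.+-suc (mu j) j))

    swapSecond : ∀ a b c d → (a ℕ.+ b) ℕ.+ (c ℕ.+ d) ≡ (a ℕ.+ d) ℕ.+ (c ℕ.+ b)
    swapSecond = ℕ-solve-∀

    -- The hypothesis compares (`lam i` - i) + (j - `mu j`) with its value at (r, t). The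
    -- subtractions are moved across in such a way that row terms and column terms stay apart and
    -- can be bounded separately.
    index<top : ∀ {i j} →
      lam i ℕ.+ toℕ r ℕ.+ (mu (toℕ t) ℕ.+ j) < lam (toℕ r) ℕ.+ i ℕ.+ (mu j ℕ.+ toℕ t) →
      lam i ℕ.+ j < mu j ℕ.+ i ℕ.+ suc top
    index<top {i} {j} lt = ℕ.+-cancelʳ-< (mu (toℕ t) ℕ.+ toℕ r) _ _ (begin-strict
      (lam i ℕ.+ j) ℕ.+ (mu (toℕ t) ℕ.+ toℕ r)
        ≡⟨ swapSecond (lam i) j (mu (toℕ t)) (toℕ r) ⟩
      (lam i ℕ.+ toℕ r) ℕ.+ (mu (toℕ t) ℕ.+ j)
        <⟨ lt ⟩
      (lam (toℕ r) ℕ.+ i) ℕ.+ (mu j ℕ.+ toℕ t)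
        ≡⟨ ℕ.+-comm (lam (toℕ r) ℕ.+ i) _ ⟩
      (mu j ℕ.+ toℕ t) ℕ.+ (lam (toℕ r) ℕ.+ i)
        ≡⟨ swapSecond (mu j) (toℕ t) (lam (toℕ r)) i ⟩
      (mu j ℕ.+ i) ℕ.+ (lam (toℕ r) ℕ.+ toℕ t)
        ≡⟨ ≡.cong (mu j ℕ.+ i ℕ.+_) corner≡ ⟩
      (mu j ℕ.+ i) ℕ.+ (mu (toℕ t) ℕ.+ toℕ r ℕ.+ suc top)
        ≡⟨ x∙yz≈xz∙y (mu j ℕ.+ i) _ (suc top) ⟩
      (mu j ℕ.+ i ℕ.+ suc top) ℕ.+ (mu (toℕ t) ℕ.+ toℕ r)
        ∎)
      where
      open ℕ.≤-Reasoning
      open Algebra.Properties.CommutativeSemigroup ℕ.+-commutativeSemigroup using (x∙yz≈xz∙y)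

    -- Strictness comes from the row terms here and from the column terms in `index≢first`.
    index≢lower : ∀ {i j} → toℕ r < i → j ≤ toℕ t → lam i ℕ.+ j < mu j ℕ.+ i ℕ.+ suc top
    index≢lower r<i j≤t = index<top
      (ℕ.+-mono-<-≤ (ℕ.+-mono-≤-< (lam≤ (ℕ.<⇒≤ r<i)) r<i) (ℕ.+-mono-≤ (mu≤ j≤t) j≤t))

    index≢first : ∀ {j} → j < toℕ t → lam (toℕ r) ℕ.+ j < mu j ℕ.+ toℕ r ℕ.+ suc top
    index≢first {j} j<t = index<top {toℕ r} {j}
      (ℕ.+-monoʳ-< (lam (toℕ r) ℕ.+ toℕ r) (ℕ.+-mono-≤-< (mu≤ (ℕ.<⇒≤ j<t)) j<t))

  module _ {c ℓ} (R : CommutativeRing c ℓ) where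
    open CommutativeRing R
    open Determinant R
    open Evaluation R
    open Algebra.Properties.Semiring.Exp semiring using (_^_)

    private
      jacobiTrudi : Fin ℓ[ outer s ] → Fin ℓ[ outer s ] → Polynomial
      jacobiTrudi i j = h (index s (toℕ i) (toℕ j))

      JT : (ℕ → Carrier) → Matrix ℓ[ outer s ]
      JT z i j = eval rawRing z (jacobiTrudi i j)

      JT-at : ∀ z i j {d} → (lam (toℕ i) ℕ.+ toℕ j) ⊖ (mu (toℕ j) ℕ.+ toℕ i) ≡ d →
        JT z i j ≈ eval rawRing z (h d)
      JT-at z i j eq = reflexive (≡.cong (eval rawRing z ∘ h)
        (≡.trans (index≡⊖ s (toℕ i) (toℕ j)) eq))

      JT≈0 : ∀ z i j → lam (toℕ i) ℕ.+ toℕ j < mu (toℕ j) ℕ.+ toℕ i → JT z i j ≈ 0#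
      JT≈0 z i j lt = JT-at z i j (proj₂ (⊖-negative lt))

      JT≈1 : ∀ z i j → lam (toℕ i) ℕ.+ toℕ j ≡ mu (toℕ j) ℕ.+ toℕ i → JT z i j ≈ 1#
      JT≈1 z i j eq = trans
        (JT-at z i j (⊖≡ (mu (toℕ j) ℕ.+ toℕ i) 0 (≡.trans eq (≡.sym (ℕ.+-identityʳ _))))) (eval-h-0 z)

      JT-shape : ∀ z → RibbonShape (toℕ r) (toℕ t) (JT z)
      JT-shape z = record
        { outside = λ i j j<i out → JT≈0 z i j (index-outside j<i out)
        ; below   = λ i j 1+j<i → JT≈0 z i j (index-below 1+j<i)
        ; diag    = λ i out → JT≈1 z i i (≡.cong (ℕ._+ toℕ i) (emptyRows (toℕ i) out))
        ; subdiag = λ i j r≤j j<t i≡1+j → JT≈1 z i j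
            (≡.subst (λ k → lam k ℕ.+ toℕ j ≡ mu (toℕ j) ℕ.+ k) (≡.sym i≡1+j)
              (index-subdiag r≤j j<t))
        }

      JT-corner : ∀ z → JT z r t ≈ z top
      JT-corner z = trans (JT-at z r t (⊖≡ (mu (toℕ t) ℕ.+ toℕ r) (suc top) corner≡)) (eval-h-suc z top)

    unit : Carrier
    unit = (- 1#) ^ (toℕ t ∸ toℕ r)

    -- The splitting ±h_n + g in terms of values: g takes the same value at z and z′.
    eval-skewSchur : ∀ z z′ → (∀ i → i ≢ top → z i ≈ z′ i) →
      eval rawRing z (skewSchur s) ≈ eval rawRing z′ (skewSchur s) + unit * (z top - z′ top)
    eval-skewSchur z z′ agree = begin
      eval rawRing z (skewSchur s)
        ≈⟨ eval-det z jacobiTrudi ⟩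
      ∣ JT z ∣
        ≈⟨ det-cornerChange r t (JT z) (JT z′) r≤t (JT-shape z) (JT-shape z′)
             (λ i j r<i j≤t → JT-cong i j (index≢lower r<i j≤t))
             (λ j j<t → JT-cong r j (index≢first j<t)) ⟩
      ∣ JT z′ ∣ + unit * (JT z r t - JT z′ r t)
        ≈⟨ +-cong (sym (eval-det z′ jacobiTrudi))
             (*-congˡ (+-cong (JT-corner z) (-‿cong (JT-corner z′)))) ⟩
      eval rawRing z′ (skewSchur s) + unit * (z top - z′ top)
        ∎
      where
      open Relation.Binary.Reasoning.Setoid setoid

      JT-cong : ∀ i j → lam (toℕ i) ℕ.+ toℕ j < mu (toℕ j) ℕ.+ toℕ i ℕ.+ suc top →
        JT z i j ≈ JT z′ i j
      JT-cong i j lt = eval-h-cong agree (index s (toℕ i) (toℕ j))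
        λ eq → ⊖≢ lt (≡.trans (≡.sym (index≡⊖ s (toℕ i) (toℕ j))) eq)

    unit*unit≈1 : unit * unit ≈ 1#
    unit*unit≈1 = square (toℕ t ∸ toℕ r)
      where
      open Algebra.Properties.Ring ring using (-‿distribˡ-*; -‿distribʳ-*; -‿involutive)
      open Algebra.Properties.CommutativeSemigroup *-commutativeSemigroup using (interchange)
      square : ∀ n → (- 1#) ^ n * (- 1#) ^ n ≈ 1#
      square zero    = *-identityˡ 1#
      square (suc n) = trans (interchange _ _ _ _) (trans (*-cong
        (trans (sym (-‿distribˡ-* _ _)) (trans (-‿cong (*-identityˡ _)) (-‿involutive _)))
        (square n)) (*-identityˡ 1#))

-- The coefficient of the top variable

-- The dual numbers ℤ[ε]: evaluation at hᵢ₊₁ = w i ε reads off the linear part.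
dualNumbers : CommutativeRing 0ℓ 0ℓ
dualNumbers = record
  { isCommutativeRing = record
    { isRing = Idealization.isRingᴺ ℤ.+-*-ring TensorUnit.bimodule
    ; *-comm = λ (a , a′) (b , b′) → ℤ.*-comm a b ,
        ≡.trans (ℤ.+-comm (a ℤ.* b′) (a′ ℤ.* b)) (≡.cong₂ ℤ._+_ (ℤ.*-comm a′ b) (ℤ.*-comm a b′))
    }
  }

private
  module D = CommutativeRing dualNumbers

-- The ε-part of a monomial at the values `w i` ε. Since ε² = 0, only words of length one have one.
linearCoeff : (ℕ → ℤ) → Monomial → ℤ
linearCoeff w []          = 0ℤ
linearCoeff w (i ∷ [])    = w i
linearCoeff w (_ ∷ _ ∷ _) = 0ℤ

infinitesimal : (ℕ → ℤ) → ℕ → D.Carrier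
infinitesimal w i = 0ℤ , w i

evalMonomial-linear : ∀ w m →
  proj₂ (evalMonomial D.rawRing (infinitesimal w) m) ≡ linearCoeff w m
evalMonomial-linear w []          = ≡.refl
evalMonomial-linear w (i ∷ [])    = ≡.trans (ℤ.+-identityˡ _) (ℤ.*-identityʳ (w i))
evalMonomial-linear w (i ∷ j ∷ m) = ≡.trans (ℤ.+-identityˡ _) (ℤ.*-zeroʳ (w i))

fromℕ-dual : ∀ n → fromℤ D.rawRing (+ n) ≡ (+ n , 0ℤ)
fromℕ-dual zero    = ≡.refl
fromℕ-dual (suc n) = ≡.cong (D.1# D.+_) (fromℕ-dual n)

fromℤ-dual : ∀ a → fromℤ D.rawRing a ≡ (a , 0ℤ)
fromℤ-dual (+ n)    = fromℕ-dual n
fromℤ-dual -[1+ n ] = ≡.cong D.-_ (fromℕ-dual (suc n))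

evalTerm-linear : ∀ w a m →
  proj₂ (evalTerm D.rawRing (infinitesimal w) (a , m)) ≡ a ℤ.* linearCoeff w m
evalTerm-linear w a m rewrite fromℤ-dual a | evalMonomial-linear w m = ℤ.+-identityʳ _

δ : ℕ → ℕ → ℤ
δ k i = if does (i ℕ.≟ k) then 1ℤ else 0ℤ

δ-same : ∀ k → δ k k ≡ 1ℤ
δ-same k rewrite dec-true (k ℕ.≟ k) ≡.refl = ≡.refl

δ-other : ∀ {k i} → i ≢ k → δ k i ≡ 0ℤ
δ-other {k} {i} i≢k rewrite dec-false (i ℕ.≟ k) i≢k = ≡.refl

≈ₘ-singleton : ∀ {m k} → m ≈ₘ [ k ] → m ≡ [ k ]
≈ₘ-singleton {m} {k} eq =
  ↭-singleton-inv (↭-trans (↭-sym (sort-↭ m)) (↭-trans (↭-reflexive eq) (sort-↭ [ k ])))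

linearCoeff-other : ∀ {k} m → m ≢ [ k ] → linearCoeff (δ k) m ≡ 0ℤ
linearCoeff-other []          m≢ = ≡.refl
linearCoeff-other (i ∷ [])    m≢ = δ-other λ i≡k → m≢ (≡.cong [_] i≡k)
linearCoeff-other (_ ∷ _ ∷ _) m≢ = ≡.refl

-- With the weights `δ k`, no word but `[ k ]` has an ε-part, and by `≈ₘ-singleton` no other word
-- counts towards this coefficient.
eval-linear : ∀ k f → proj₂ (eval D.rawRing (infinitesimal (δ k)) f) ≡ coeff f [ k ]
eval-linear k []            = ≡.refl
eval-linear k ((a , m) ∷ f) with m ≈ₘ? [ k ]
... | yes m≈ with ≡.refl ← ≈ₘ-singleton m≈ = ≡.cong₂ ℤ._+_
  (≡.trans (evalTerm-linear (δ k) a [ k ])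
    (≡.trans (≡.cong (a ℤ.*_) (δ-same k)) (ℤ.*-identityʳ a)))
  (eval-linear k f)
... | no m≉ = ≡.trans (≡.cong₂ ℤ._+_
  (≡.trans (evalTerm-linear (δ k) a m)
    (≡.trans (≡.cong (a ℤ.*_) (linearCoeff-other m λ m≡ → m≉ (≡.cong sort m≡))) (ℤ.*-zeroʳ a)))
  (eval-linear k f)) (ℤ.+-identityˡ _)

linearCoeff-0 : ∀ m → linearCoeff (λ _ → 0ℤ) m ≡ 0ℤ
linearCoeff-0 []          = ≡.refl
linearCoeff-0 (_ ∷ [])    = ≡.refl
linearCoeff-0 (_ ∷ _ ∷ _) = ≡.refl

eval-linear-0 : ∀ f → proj₂ (eval D.rawRing (infinitesimal λ _ → 0ℤ) f) ≡ 0ℤ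
eval-linear-0 []            = ≡.refl
eval-linear-0 ((a , m) ∷ f) = ≡.cong₂ ℤ._+_
  (≡.trans (evalTerm-linear (λ _ → 0ℤ) a m)
    (≡.trans (≡.cong (a ℤ.*_) (linearCoeff-0 m)) (ℤ.*-zeroʳ a)))
  (eval-linear-0 f)

module _ (s : SkewPartition) (rows : RibbonRows s) where
  private
    k = top s rows
    u = unit s rows dualNumbers

  -- Compare the evaluation with h_n = ε and all other variables 0 with the one where all are 0. The
  -- ε-part of the difference is the coefficient on one side and the integer part of the sign u on
  -- the other, which cannot vanish because u squares to 1.
  coeff-top≢0 : coeff (skewSchur s) [ k ] ≢ 0ℤ
  coeff-top≢0 coeff≡0 = contradiction 1≡0 λ ()
    where
    open ≡.≡-Reasoning

    u₁≡0 : proj₁ u ≡ 0ℤ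
    u₁≡0 = begin
      proj₁ u
        ≡⟨ ℤ.*-identityʳ (proj₁ u) ⟨
      proj₁ u ℤ.* 1ℤ
        ≡⟨ ≡.cong (λ d → proj₁ u ℤ.* (d ℤ.+ 0ℤ)) (δ-same k) ⟨
      proj₁ u ℤ.* (δ k k ℤ.+ 0ℤ)
        ≡⟨ ℤ.+-identityʳ _ ⟨
      proj₁ u ℤ.* (δ k k ℤ.+ 0ℤ) ℤ.+ 0ℤ
        ≡⟨ ≡.cong (λ d → proj₁ u ℤ.* (δ k k ℤ.+ 0ℤ) ℤ.+ d) (ℤ.*-zeroʳ (proj₂ u)) ⟨
      proj₂ (u D.* (infinitesimal (δ k) k D.- D.0#))
        ≡⟨ ℤ.+-identityˡ _ ⟨
      0ℤ ℤ.+ proj₂ (u D.* (infinitesimal (δ k) k D.- D.0#))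
        ≡⟨ ≡.cong (ℤ._+ proj₂ (u D.* (infinitesimal (δ k) k D.- D.0#))) (eval-linear-0 (skewSchur s)) ⟨
      proj₂ (eval D.rawRing (infinitesimal λ _ → 0ℤ) (skewSchur s)) ℤ.+
        proj₂ (u D.* (infinitesimal (δ k) k D.- D.0#))
        ≡⟨ proj₂ (eval-skewSchur s rows dualNumbers (infinitesimal (δ k)) (infinitesimal λ _ → 0ℤ)
             λ i i≢k → ≡.refl , δ-other i≢k) ⟨
      proj₂ (eval D.rawRing (infinitesimal (δ k)) (skewSchur s))
        ≡⟨ eval-linear k (skewSchur s) ⟩
      coeff (skewSchur s) [ k ]
        ≡⟨ coeff≡0 ⟩
      0ℤ
        ∎

    1≡0 : 1ℤ ≡ 0ℤ
    1≡0 = begin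
      1ℤ                  ≡⟨ proj₁ (unit*unit≈1 s rows dualNumbers) ⟨
      proj₁ u ℤ.* proj₁ u ≡⟨ ≡.cong (ℤ._* proj₁ u) u₁≡0 ⟩
      0ℤ                  ∎

  top< : ∀ {N} → InvolvesOnly N (skewSchur s) → k < N
  top< involves = All.head (involves [ k ] coeff-top≢0)

-- Counting

private
  variable
    a b c p : Level
    A : Set a
    B : Set b
    C : Set c

module _ {P : Pred A p} (P? : Decidable P) where
  count : List A → ℕ
  count xs = length (filter P? xs)

  count-++ : ∀ xs ys → count (xs ++ ys) ≡ count xs ℕ.+ count ys
  count-++ xs ys = ≡.trans (≡.cong length (filter-++ P? xs ys)) (length-++ (filter P? xs))

  count-tabulate-unique : ∀ {n} (f : Fin n → A) i → P (f i) → (∀ j → j ≢ i → ¬ P (f j)) →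
    count (tabulate f) ≡ 1
  count-tabulate-unique f Fin.zero    Pfi others = ≡.cong length (≡.trans
    (filter-accept P? Pfi)
    (≡.cong (f Fin.zero ∷_) (filter-none P? (All.tabulate⁺ λ j → others (Fin.suc j) λ ()))))
  count-tabulate-unique f (Fin.suc i) Pfi others = ≡.trans
    (≡.cong length (filter-reject P? (others Fin.zero λ ())))
    (count-tabulate-unique (f ∘ Fin.suc) i Pfi λ j j≢i → others (Fin.suc j) (j≢i ∘ suc-injective))

count-map : ∀ {P : Pred B p} (P? : Decidable P) (f : A → B) xs →
  count P? (map f xs) ≡ count (P? ∘ f) xs
count-map P? f []       = ≡.refl
count-map P? f (x ∷ xs) with P? (f x)
... | yes _ = ≡.cong suc (count-map P? f xs)
... | no  _ = count-map P? f xs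

length-cartesianProductWith : ∀ (f : A → B → C) xs ys →
  length (cartesianProductWith f xs ys) ≡ length xs ℕ.* length ys
length-cartesianProductWith f []       ys = ≡.refl
length-cartesianProductWith f (x ∷ xs) ys = ≡.trans (length-++ (map (f x) ys))
  (≡.cong₂ ℕ._+_ (length-map (f x) ys) (length-cartesianProductWith f xs ys))

module _ {P : Pred C p} (P? : Decidable P) (f : A → B → C) where
  count-rows : ∀ xs ys {m} → (∀ x → count (P? ∘ f x) ys ≡ m) →
    count P? (cartesianProductWith f xs ys) ≡ length xs ℕ.* m
  count-rows []       ys rows = ≡.refl
  count-rows (x ∷ xs) ys rows = ≡.trans (count-++ P? (map (f x) ys) _)
    (≡.cong₂ ℕ._+_ (≡.trans (count-map P? (f x) ys) (rows x)) (count-rows xs ys rows))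

  private
    count-[] : ∀ xs → count P? (cartesianProductWith f xs []) ≡ 0
    count-[] []       = ≡.refl
    count-[] (x ∷ xs) = count-[] xs

    -- The product is listed row by row, so the entries of the column y are scattered over it;
    -- induction on the rows collects them.
    count-∷ : ∀ xs y ys → count P? (cartesianProductWith f xs (y ∷ ys)) ≡
      count (λ x → P? (f x y)) xs ℕ.+ count P? (cartesianProductWith f xs ys)
    count-∷ []       y ys = ≡.refl
    count-∷ (x ∷ xs) y ys = begin
      count P? (map (f x) (y ∷ ys) ++ product (y ∷ ys))
        ≡⟨ count-++ P? (map (f x) (y ∷ ys)) (product (y ∷ ys)) ⟩
      count P? (map (f x) (y ∷ ys)) ℕ.+ count P? (product (y ∷ ys))
        ≡⟨ ≡.cong₂ ℕ._+_ (count-++ P? [ f x y ] (map (f x) ys)) (count-∷ xs y ys) ⟩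
      (count P? [ f x y ] ℕ.+ count P? (map (f x) ys)) ℕ.+ (count Py? xs ℕ.+ count P? (product ys))
        ≡⟨ interchange (count P? [ f x y ]) _ _ _ ⟩
      (count P? [ f x y ] ℕ.+ count Py? xs) ℕ.+ (count P? (map (f x) ys) ℕ.+ count P? (product ys))
        ≡⟨ ≡.cong₂ ℕ._+_ (≡.cong (ℕ._+ count Py? xs) (count-map P? (λ x → f x y) [ x ]))
                         (≡.sym (count-++ P? (map (f x) ys) (product ys))) ⟩
      (count Py? [ x ] ℕ.+ count Py? xs) ℕ.+ count P? (map (f x) ys ++ product ys)
        ≡⟨ ≡.cong (ℕ._+ count P? (map (f x) ys ++ product ys)) (count-++ Py? [ x ] xs) ⟨
      count Py? (x ∷ xs) ℕ.+ count P? (map (f x) ys ++ product ys)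
        ∎
      where
      open ≡.≡-Reasoning
      open Algebra.Properties.CommutativeSemigroup ℕ.+-commutativeSemigroup using (interchange)
      product = cartesianProductWith f xs
      Py? : Decidable (λ x → P (f x y))
      Py? x = P? (f x y)

  count-columns : ∀ xs ys {m} → (∀ y → count (λ x → P? (f x y)) xs ≡ m) →
    count P? (cartesianProductWith f xs ys) ≡ length ys ℕ.* m
  count-columns xs []       columns = count-[] xs
  count-columns xs (y ∷ ys) columns = ≡.trans (count-∷ xs y ys)
    (≡.cong₂ ℕ._+_ (columns y) (count-columns xs ys columns))

-- `_/_` reduces to lowest terms. Unnormalised fractions are compared by cross products, and
-- equivalent ones have the same normal form.
/-cross : ∀ m n d e .{{_ : NonZero d}} .{{_ : NonZero e}} →
  m ℤ.* + e ≡ n ℤ.* + d → m / d ≡ n / e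
/-cross m n (suc d) (suc e) eq = fromℚᵘ-cong {mkℚᵘ m d} {mkℚᵘ n e} (*≡* eq)

-- Counting solutions over a finite field

module _ {c ℓ₁ ℓ₂ q} (F : FiniteField c ℓ₁ ℓ₂ q) where
  open FiniteField F

  -- The enumeration meets each class of `_≈_` exactly once, that of b at the index `to b`.
  count-elements : ∀ {P : Pred Carrier p} (P? : Decidable P) b → (∀ x → P x ⇔ x ≈ b) →
    count P? elements ≡ 1
  count-elements {P = P} P? b P⇔≈b =
    ≡.trans (≡.cong (count P?) (map-tabulate (λ i → i) from))
      (count-tabulate-unique P? from (to b)
        (Equivalence.from (P⇔≈b _) (Inverse.strictlyInverseʳ enumeration b))
        λ j j≢ Pj → j≢ (≡.trans (≡.sym (Inverse.strictlyInverseˡ enumeration j))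
          (Inverse.to-cong enumeration (Equivalence.to (P⇔≈b _) Pj))))

  length-elements : length elements ≡ q
  length-elements = ≡.trans (length-map from (allFin q)) (length-tabulate (λ i → i))

  length-tuples : ∀ N → length (tuples N) ≡ q ℕ.^ N
  length-tuples zero    = ≡.refl
  length-tuples (suc N) = ≡.trans (length-cartesianProductWith Vec._∷_ elements (tuples N))
    (≡.cong₂ ℕ._*_ length-elements (length-tuples N))

  -- The N entries other than the one at k are free and determine it. Entries before k are fixed one
  -- by one, as rows of the product; at k itself the count goes over columns, one for each remaining
  -- tail.
  count-tuples : ∀ {N} {P : Pred (Vec Carrier (suc N)) p} (P? : Decidable P) (k : Fin (suc N)) →
    (∀ v → ∃ λ b → ∀ x → P (v [ k ]≔ x) ⇔ x ≈ b) → count P? (tuples (suc N)) ≡ q ℕ.^ N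
  count-tuples {N = N} P? Fin.zero solve = ≡.trans
    (count-columns P? Vec._∷_ elements (tuples N) λ v →
      -- The zero is a placeholder, which the update overwrites.
      let b , P⇔≈b = solve (0# Vec.∷ v) in count-elements (λ x → P? (x Vec.∷ v)) b P⇔≈b)
    (≡.trans (ℕ.*-identityʳ _) (length-tuples N))
  count-tuples {N = suc N} P? (Fin.suc k) solve = ≡.trans
    (count-rows P? Vec._∷_ elements (tuples (suc N)) λ x →
      count-tuples (λ v → P? (x Vec.∷ v)) k λ v → solve (x Vec.∷ v))
    (≡.cong (ℕ._* q ℕ.^ N) length-elements)

  assign-≔ : ∀ {N} (v : Vec Carrier N) k x → assign rawRing (v [ k ]≔ x) (toℕ k) ≡ x
  assign-≔ (_ Vec.∷ v) Fin.zero    x = ≡.refl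
  assign-≔ (_ Vec.∷ v) (Fin.suc k) x = assign-≔ v k x

  assign-≔-other : ∀ {N} (v : Vec Carrier N) k x y i → i ≢ toℕ k →
    assign rawRing (v [ k ]≔ x) i ≡ assign rawRing (v [ k ]≔ y) i
  assign-≔-other (_ Vec.∷ v) Fin.zero    x y zero    i≢k = contradiction ≡.refl i≢k
  assign-≔-other (_ Vec.∷ v) Fin.zero    x y (suc i) i≢k = ≡.refl
  assign-≔-other (_ Vec.∷ v) (Fin.suc k) x y zero    i≢k = ≡.refl
  assign-≔-other (_ Vec.∷ v) (Fin.suc k) x y (suc i) i≢k =
    assign-≔-other v k x y i (i≢k ∘ ≡.cong suc)

  -- The sign u is its own inverse. The term `x - 0#` arises because 0 serves as the reference value
  -- of h_n.
  affine-solution : ∀ {u e a} → u * u ≈ 1# → ∀ x → (e + u * (x - 0#) ≈ a) ⇔ (x ≈ u * (a - e))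
  affine-solution {u} {e} {a} u²≈1 x = mk⇔
    (λ eq → begin
      x               ≈⟨ uu*y≈y x ⟨
      u * (u * x)     ≈⟨ *-congˡ (x+y≈z⇒y≈z-x (trans (+-congˡ (*-congˡ (sym x-0≈x))) eq)) ⟩
      u * (a - e)     ∎)
    (λ eq → begin
      e + u * (x - 0#)          ≈⟨ +-congˡ (*-congˡ (trans x-0≈x eq)) ⟩
      e + u * (u * (a - e))     ≈⟨ +-congˡ (uu*y≈y (a - e)) ⟩
      e + (a - e)               ≈⟨ +-assoc _ _ _ ⟨
      e + a - e                 ≈⟨ xyx⁻¹≈y e a ⟩
      a                         ∎)
    where
    open Algebra.Properties.AbelianGroup +-abelianGroup using (xyx⁻¹≈y)
    open Algebra.Properties.Ring ring using (-0#≈0#)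
    open Relation.Binary.Reasoning.Setoid setoid

    x-0≈x : x - 0# ≈ x
    x-0≈x = trans (+-congˡ -0#≈0#) (+-identityʳ x)

    uu*y≈y : ∀ y → u * (u * y) ≈ y
    uu*y≈y y = trans (sym (*-assoc u u y)) (trans (*-congʳ u²≈1) (*-identityˡ y))

    x+y≈z⇒y≈z-x : ∀ {y} → e + y ≈ a → y ≈ a - e
    x+y≈z⇒y≈z-x {y} eq = trans (sym (xyx⁻¹≈y e y)) (+-congʳ eq)

  module _ (s : SkewPartition) (rows : RibbonRows s) (a : Carrier) where
    skewSchur-solution : ∀ {N} (v : Vec Carrier N) k → toℕ k ≡ top s rows →
      ∃ λ b → ∀ x → (eval rawRing (assign rawRing (v [ k ]≔ x)) (skewSchur s) ≈ a) ⇔ (x ≈ b)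
    skewSchur-solution v k k≡top =
      -- At h_n = 0 only g remains, so `value 0#` is the value of g.
      u * (a - value 0#) , λ x →
        let open Equivalence (affine-solution u²≈1 x) renaming (to to solve; from to check)
        in mk⇔ (λ eq → solve (trans (sym (affine x)) eq)) (λ eq → trans (affine x) (check eq))
      where
      u = unit s rows commutativeRing
      u²≈1 = unit*unit≈1 s rows commutativeRing

      value : Carrier → Carrier
      value x = eval rawRing (assign rawRing (v [ k ]≔ x)) (skewSchur s)

      at-top : ∀ x → assign rawRing (v [ k ]≔ x) (top s rows) ≡ x
      at-top x = ≡.subst (λ i → assign rawRing (v [ k ]≔ x) i ≡ x) k≡top (assign-≔ v k x)

      affine : ∀ x → value x ≈ value 0# + u * (x - 0#)
      affine x = trans
        (eval-skewSchur s rows commutativeRing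
          (assign rawRing (v [ k ]≔ x)) (assign rawRing (v [ k ]≔ 0#))
          λ i i≢top → reflexive (assign-≔-other v k x 0# i λ i≡k → i≢top (≡.trans i≡k k≡top)))
        (reflexive (≡.cong₂ (λ y z → value 0# + u * (y - z)) (at-top x) (at-top 0#)))

  q^N/q^[1+N]≡1/q : ∀ N →
    ((+ (q ℕ.^ N)) / (q ℕ.^ suc N)) {{ℕ.m^n≢0 q (suc N) {{q≢0}}}} ≡ (1ℤ / q) {{q≢0}}
  q^N/q^[1+N]≡1/q N = /-cross (+ (q ℕ.^ N)) 1ℤ (q ℕ.^ suc N) q
    {{ℕ.m^n≢0 q (suc N) {{q≢0}}}} {{q≢0}} (begin
    + (q ℕ.^ N) ℤ.* + q     ≡⟨ ℤ.*-comm (+ (q ℕ.^ N)) (+ q) ⟩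
    + q ℤ.* + (q ℕ.^ N)     ≡⟨ ℤ.pos-* q (q ℕ.^ N) ⟨
    + (q ℕ.^ suc N)         ≡⟨ ℤ.*-identityˡ (+ (q ℕ.^ suc N)) ⟨
    1ℤ ℤ.* + (q ℕ.^ suc N)  ∎)
    where open ≡.≡-Reasoning

  probability-skewSchur : ∀ s (rows : RibbonRows s) a N → top s rows < N →
    probability F N (skewSchur s) a ≡ (1ℤ / q) {{q≢0}}
  probability-skewSchur s rows a (suc N) k<N = ≡.trans
    (≡.cong (λ m → ((+ m) / (q ℕ.^ suc N)) {{ℕ.m^n≢0 q (suc N) {{q≢0}}}})
      (count-tuples (λ z → eval rawRing (assign rawRing z) (skewSchur s) ≟ a) (fromℕ< k<N)
        λ v → skewSchur-solution s rows a v (fromℕ< k<N) (toℕ-fromℕ< k<N)))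
    (q^N/q^[1+N]≡1/q N)

theorem6p5 : ∀ {c ℓ₁ ℓ₂} (q : ℕ) (F : FiniteField c ℓ₁ ℓ₂ q)
    (s : SkewPartition) → Ribbon s → (a : FiniteField.Carrier F) →
    (N : ℕ) → InvolvesOnly N (skewSchur s) →
    probability F N (skewSchur s) a ≡ (1ℤ / q) {{FiniteField.q≢0 F}}
theorem6p5 q F s ribbon a N involves =
  probability-skewSchur F s rows a N (top< s rows involves)
  where rows = ribbonRows s ribbon
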